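{- Let $G$ be a finite graph, let $R(G)$ be a residual graph of $G$, and let $H=G\setminus V(R(G))$. Then (i) $\gamma_{\rm MB}'(G)=\frac{n(H)}{2}+\gamma_{\rm MB}'(R(G))$; (ii) $\frac{n(H)}{2}+\gamma_{\rm MB}(R(G))-1\le \gamma_{\rm MB}(G)\le \frac{n(H)}{2}+\gamma_{\rm MB}(R(G))$.
   Context: All graphs are finite and simple; $n(X)$ is the number of vertices of $X$. A pendant $P_2$ in a graph is a path $xy$ attached to the rest of the graph by a single edge, i.e. $x$ has degree $1$, its unique neighbor $y$ has degree $2$, and $y$ has exactly one other neighbor; removing it deletes $x$ and $y$. If the current graph is itself $P_2$, it may also be removed, leaving the empty graph. The residual graph $R(G)$ is obtained from $G$ by iteratively removing pendant $P_2$'s until none is present. The Maker-Breaker domination game on a graph: Dominator and Staller alternately select a vertex not selected before; Dominator wins if at some point his selected vertices form a dominating set, Staller wins otherwise. In the D-game Dominator moves first, in the S-game Staller moves first. $\gamma_{\rm MB}(G)$ (resp. $\gamma_{\rm MB}'(G)$) is the minimum $k$ such that Dominator has a strategy in the D-game (resp. S-game) guaranteeing that his selected vertices dominate the graph after at most $k$ of his moves, whatever Staller does, and is $\infty$ if he has no winning strategy. -}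

module Defs where

open import Data.Nat using (ℕ; zero; suc; _+_; _∸_; _≤_; _<_)
open import Data.Bool using (Bool; true; false; _∧_; _∨_; not; if_then_else_)
open import Data.Fin using (Fin; _≟_)
import Data.Fin as Fin
open import Data.Product using (Σ; ∃; _×_; _,_)
open import Data.Sum using (_⊎_)
open import Relation.Nullary using (¬_)
open import Relation.Nullary.Decidable using (⌊_⌋)
open import Relation.Binary.PropositionalEquality using (_≡_)
open import Relation.Binary.Construct.Closure.ReflexiveTransitive using (Star)

record Graph (n : ℕ) : Set where
  field
    adj    : Fin n → Fin n → Bool
    sym    : ∀ u v → adj u v ≡ adj v u
    irrefl : ∀ v → adj v v ≡ false
open Graph public

-- Vertex subsets of Fin n, as Boolean predicates.  An induced subgraph
-- of G is represented by G together with its vertex set S.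
VSet : ℕ → Set
VSet n = Fin n → Bool

full : ∀ {n} → VSet n
full _ = true

empty : ∀ {n} → VSet n
empty _ = false

card : ∀ {n} → VSet n → ℕ
card {zero}  S = 0
card {suc n} S = (if S Fin.zero then 1 else 0) + card (λ i → S (Fin.suc i))

add : ∀ {n} → VSet n → Fin n → VSet n
add D v u = D u ∨ ⌊ u ≟ v ⌋

deg : ∀ {n} → Graph n → VSet n → Fin n → ℕ
deg G S v = card (λ u → S u ∧ adj G v u)

data Step {n} (G : Graph n) (S : VSet n) (T : VSet n) : Set where
  pendant : (x y : Fin n) → S x ≡ true → S y ≡ true → adj G x y ≡ true →
            deg G S x ≡ 1 → deg G S y ≡ 2 →
            (∀ v → T v ≡ (S v ∧ not ⌊ v ≟ x ⌋ ∧ not ⌊ v ≟ y ⌋)) →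
            Step G S T
  wholeP2 : (x y : Fin n) → S x ≡ true → S y ≡ true → adj G x y ≡ true →
            (∀ v → S v ≡ true → v ≡ x ⊎ v ≡ y) →
            (∀ v → T v ≡ false) →
            Step G S T

Residual : ∀ {n} → Graph n → VSet n → VSet n → Set
Residual G S R = Star (Step G) S R × (∀ T → ¬ Step G R T)

module Game {n} (G : Graph n) (S : VSet n) where

  Free : VSet n → VSet n → Fin n → Set
  Free D St v = (S v ∧ not (D v) ∧ not (St v)) ≡ true

  Dominates : VSet n → Set
  Dominates D = ∀ v → S v ≡ true →
    Σ (Fin n) λ u → S u ≡ true × D u ≡ true × (u ≡ v ⊎ adj G u v ≡ true)

  -- WinD k D St : Dominator to move; he can force domination within k
  -- more of his own moves.  WinS: same, Staller to move.
  data WinD : ℕ → VSet n → VSet n → Set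
  data WinS : ℕ → VSet n → VSet n → Set

  data WinD where
    doneD : ∀ {k D St} → Dominates D → WinD k D St
    moveD : ∀ {k D St} (v : Fin n) → Free D St v →
            WinS k (add D v) St → WinD (suc k) D St

  data WinS where
    doneS : ∀ {k D St} → Dominates D → WinS k D St
    moveS : ∀ {k D St} → (Σ (Fin n) λ v → Free D St v) →
            (∀ v → Free D St v → WinD k D (add St v)) → WinS k D St

data ℕ∞ : Set where
  fin : ℕ → ℕ∞
  ∞   : ℕ∞

_+∞_ : ℕ → ℕ∞ → ℕ∞
a +∞ fin b = fin (a + b)
a +∞ ∞     = ∞

pred∞ : ℕ∞ → ℕ∞
pred∞ (fin a) = fin (a ∸ 1)
pred∞ ∞       = ∞

data _≤∞_ : ℕ∞ → ℕ∞ → Set where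
  fin≤fin : ∀ {a b} → a ≤ b → fin a ≤∞ fin b
  ≤∞∞     : ∀ {x} → x ≤∞ ∞

GammaD : ∀ {n} → Graph n → VSet n → ℕ∞ → Set
GammaD G S (fin k) = WinD k empty empty × (∀ j → j < k → ¬ WinD j empty empty)
  where open Game G S
GammaD G S ∞ = ∀ k → ¬ WinD k empty empty
  where open Game G S

GammaS : ∀ {n} → Graph n → VSet n → ℕ∞ → Set
GammaS G S (fin k) = WinS k empty empty × (∀ j → j < k → ¬ WinS j empty empty)
  where open Game G S
GammaS G S ∞ = ∀ k → ¬ WinS k empty empty
  where open Game G S

{-# OPTIONS --safe #-}
-- A position is a hypergraph: the closed neighbourhoods still to be hit, shrunk
-- by Staller's moves.  A position each of whose edges contains an edge of another
-- one is at least as good for Dominator, which makes all comparisons of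
-- positions inclusions of edges.
--
-- For a pendant pair xy (x the leaf) Staller plays y and forces Dominator to take
-- x, after which the game is the one on the graph without x, y; conversely
-- Dominator can always pair x with y.  This settles the S-game and the upper bound
-- in the D-game.  For the lower bound, only an opening move on some y can
-- disturb the forcing, by dominating its outer neighbour z in advance.
-- Staller still removes the later pairs one at a time by forcing, until z is the
-- leaf of a pair ab; that pair stays as a tail at its outer neighbour w until w
-- itself is the leaf x of a pair xy with outer neighbour z′.  On the path a b x y z′
-- Staller plays x, and Dominator has to answer b or y.  After b, only a leaf y is left
-- hanging at z′; after y, z′ is dominated in advance as z was.  In all these
-- positions Dominator has gained at most one move.
module Submission where

open import Defs
open import Data.Nat using (ℕ; _∸_; _/_; zero; suc; _+_; _*_; _≤_; z≤n; s≤s)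
open import Data.Nat.DivMod using (m*n/n≡m)
open import Data.Nat.Properties using (≤-refl; ≤-trans; ≤-antisym; ≮⇒≥; n≤1+n; suc-injective;
  +-suc; +-identityʳ; +-monoʳ-≤; *-comm; m+n∸n≡m; ∸-monoˡ-≤)
open import Data.Bool using (true; false; _∧_; not; if_then_else_)
import Data.Bool as Bool
open import Data.Bool.Properties using (∧-identityʳ; ∧-assoc)
open import Data.Empty using (⊥; ⊥-elim)
open import Data.Fin using (Fin; zero; suc; _≟_)
open import Data.Fin.Properties using (any?)
open import Data.Product using (_×_; _,_; proj₁; proj₂; Σ-syntax; ∃-syntax)
open import Data.Sum using (_⊎_; inj₁; inj₂; [_,_]′; swap)
open import Data.Unit using (⊤; tt)
open import Function using (_∘_; id)
open import Relation.Binary.Construct.Closure.ReflexiveTransitive using (Star; ε; _◅_)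
open import Relation.Binary.PropositionalEquality using (_≡_; _≢_; refl; trans; cong; subst; _≗_)
  renaming (sym to ≡-sym)
open import Relation.Nullary using (¬_; Dec; yes; no; contradiction)
open import Relation.Nullary.Decidable using (⌊_⌋; isYes≗does; _×-dec_; _⊎-dec_; ¬?; decidable-stable)

-- Hypergraph positions and monotonicity of the game.

record Hypergraph (V : Set) : Set₁ where
  field
    Edge : Set
    _∋_  : Edge → V → Set
open Hypergraph

private variable
  n k : ℕ
  V : Set
  H H′ : Hypergraph V

hit : Hypergraph V → V → Hypergraph V
hit H v .Edge = Σ[ e ∈ Edge H ] ¬ (H ∋ e) v
hit H v ._∋_ (e , _) = (H ∋ e)

cut : Hypergraph V → V → Hypergraph V
cut H v .Edge = Edge H
cut H v ._∋_ e u = (H ∋ e) u × u ≢ v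

_⊕_ : Hypergraph V → Hypergraph V → Hypergraph V
(H ⊕ K) .Edge = Edge H ⊎ Edge K
(H ⊕ K) ._∋_ (inj₁ e) = (H ∋ e)
(H ⊕ K) ._∋_ (inj₂ e) = (K ∋ e)

⟪_⟫ : (V → Set) → Hypergraph V
⟪ A ⟫ .Edge = ⊤
⟪ A ⟫ ._∋_ _ = A

-- Unlike in the game on a graph, vertices may be chosen repeatedly and Staller may
-- pass; by monotonicity in the position neither option is of any use.
data DWin (H : Hypergraph V) : ℕ → Set
data SWin (H : Hypergraph V) : ℕ → Set

data DWin H where
  done : ¬ Edge H → DWin H k
  move : ∀ v → SWin (hit H v) k → DWin H (suc k)

data SWin H where
  reply : DWin H k → (∀ v → DWin (cut H v) k) → SWin H k

-- H is at least as good for Dominator as H′.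
infix 4 _≼_
_≼_ : Hypergraph V → Hypergraph V → Set
H ≼ H′ = ∀ e → Σ[ e′ ∈ Edge H′ ] (∀ u → (H′ ∋ e′) u → (H ∋ e) u)

hit-mono : ∀ {v} → H ≼ H′ → hit H v ≼ hit H′ v
hit-mono p (e , v∉e) with p e
... | e′ , e′⊆e = (e′ , λ v∈ → v∉e (e′⊆e _ v∈)) , e′⊆e

cut-mono : ∀ {v} → H ≼ H′ → cut H v ≼ cut H′ v
cut-mono p e with p e
... | e′ , e′⊆e = e′ , λ { u (u∈ , u≢v) → e′⊆e u u∈ , u≢v }

DWin-mono : H ≼ H′ → DWin H′ k → DWin H k
SWin-mono : H ≼ H′ → SWin H′ k → SWin H k
DWin-mono p (done ∄e)  = done λ e → ∄e (proj₁ (p e))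
DWin-mono {H = H} {H′} p (move v s) = move v (SWin-mono (hit-mono {H = H} {H′} p) s)
SWin-mono {H = H} {H′} p (reply d f) =
  reply (DWin-mono p d) λ v → DWin-mono (cut-mono {H = H} {H′} p) (f v)

SWin⇒DWin : SWin H k → DWin H k
SWin⇒DWin (reply d _) = d

answer : SWin H k → ∀ v → DWin (cut H v) k
answer (reply _ f) = f

done-SWin : ¬ Edge H → SWin H k
done-SWin ∄e = reply (done ∄e) λ _ → done ∄e

≼-cut : ∀ v → H ≼ cut H v
≼-cut v e = e , λ _ → proj₁

-- Threats and forced replies.

lost : (e : Edge H) → (∀ u → ¬ (H ∋ e) u) → ¬ DWin H k
lost e ∅ (done ∄e) = ∄e e
-- No move of Dominator meets the empty edge, and Staller keeps it by passing.
lost e ∅ (move v (reply d _)) = lost (e , ∅ v) ∅ d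

positive : Edge H → SWin H k → ∃[ j ] k ≡ suc j
positive {k = zero}  e (reply (done ∄e) _) = ⊥-elim (∄e e)
positive {k = suc k} e _ = k , refl

Spent : ℕ → Hypergraph V → Set
Spent k H = ∃[ j ] (k ≡ suc j × SWin H j)

-- If Dominator takes any other vertex, Staller takes `q` and empties `e`.
force : ∀ {H : Hypergraph (Fin n)} e q → (∀ u → (H ∋ e) u → u ≡ q) → DWin H k → Spent k (hit H q)
force e q ⊆q (done ∄e) = ⊥-elim (∄e e)
force e q ⊆q (move v s) with v ≟ q
... | yes refl = _ , refl , s
... | no v≢q = ⊥-elim (lost (e , λ v∈ → v≢q (⊆q v v∈))
                            (λ { u (u∈ , u≢q) → u≢q (⊆q u u∈) }) (answer s q))

-- Staller takes `p`, and `q` becomes the only way to hit `e`. The round costs Dominator one move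
-- and returns the turn to Staller.
exchange : ∀ {H K : Hypergraph (Fin n)} e p q → (∀ u → (H ∋ e) u → u ≡ p ⊎ u ≡ q) →
           K ≼ hit (cut H p) q → SWin H k → Spent k K
exchange {H = H} e p q ⊆pq K≼ s
  with force {H = cut H p} e q
         (λ { u (u∈ , u≢p) → [ (λ u≡p → contradiction u≡p u≢p) , id ]′ (⊆pq u u∈) }) (answer s p)
... | j , k≡ , s′ = j , k≡ , SWin-mono K≼ s′

-- Staller takes `b`, which forces `a`, and then empties `f` by taking `c`.
double-threat : ∀ {H : Hypergraph (Fin n)} e f a b c → a ≢ c →
          (∀ u → (H ∋ e) u → u ≡ a ⊎ u ≡ b) → (∀ u → (H ∋ f) u → u ≡ b ⊎ u ≡ c) → ¬ SWin H k
double-threat {H = H} e f a b c a≢c ⊆ab ⊆bc s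
  with exchange {H = H} {K = hit (cut H b) a} e b a
         (λ u u∈ → swap (⊆ab u u∈)) (λ e → e , λ _ → id) s
... | _ , _ , s′ = lost (f , λ { (a∈ , a≢b) → [ a≢b , a≢c ]′ (⊆bc a a∈) })
                        (λ { u ((u∈ , u≢b) , u≢c) → [ u≢b , u≢c ]′ (⊆bc u u∈) })
                        (answer s′ c)

-- Taking b, and likewise taking c, would be a double threat of Staller.
path-reply : ∀ {H : Hypergraph (Fin n)} e f g a b c d → a ≢ c → a ≢ d → b ≢ d →
             (∀ u → (H ∋ e) u → u ≡ a ⊎ u ≡ b) → (∀ u → (H ∋ f) u → u ≡ b ⊎ u ≡ c) →
             (∀ u → (H ∋ g) u → u ≡ c ⊎ u ≡ d) →
             DWin H k → Spent k (hit H b) ⊎ Spent k (hit H c)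
path-reply e f g a b c d a≢c a≢d b≢d ⊆ab ⊆bc ⊆cd (done ∄e) = ⊥-elim (∄e e)
path-reply {H = H} e f g a b c d a≢c a≢d b≢d ⊆ab ⊆bc ⊆cd (move v s) with v ≟ b | v ≟ c
... | yes refl | _        = inj₁ (_ , refl , s)
... | no _     | yes refl = inj₂ (_ , refl , s)
... | no v≢b   | no v≢c with v ≟ a
...   | no v≢a = ⊥-elim (double-threat {H = hit H v}
                    (e , λ v∈ → [ v≢a , v≢b ]′ (⊆ab v v∈)) (f , λ v∈ → [ v≢b , v≢c ]′ (⊆bc v v∈))
                    a b c a≢c ⊆ab ⊆bc s)
...   | yes refl = ⊥-elim (double-threat {H = hit H v}
                    (f , λ v∈ → [ v≢b , v≢c ]′ (⊆bc v v∈)) (g , λ v∈ → [ v≢c , a≢d ]′ (⊆cd v v∈))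
                    b c d b≢d ⊆bc ⊆cd s)

-- The pairing strategy.

pair : V → V → Hypergraph V
pair p q = ⟪ (λ u → u ≡ p ⊎ u ≡ q) ⟫

module _ {n} {p q : Fin n} (p≢q : p ≢ q) where

  Avoids : Hypergraph (Fin n) → Set
  Avoids H = ∀ e → ¬ (H ∋ e) p × ¬ (H ∋ e) q

  -- Dominator answers a move in `{p, q}` by the other vertex. As `H` avoids both, such a round
  -- leaves `H` unchanged, and only the one extra move is spent.
  DWin-pair : ∀ {H k} → Avoids H → DWin H k → DWin (H ⊕ pair p q) (suc k)
  SWin-pair : ∀ {H k} → Avoids H → SWin H k → SWin (H ⊕ pair p q) (suc k)
  DWin-pair av (done ∄e) = move q (done-SWin λ { (inj₁ e , _) → ∄e e ; (inj₂ _ , q∉) → q∉ (inj₂ refl) })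
  DWin-pair {H} av (move v s) = move v (SWin-mono distrib (SWin-pair (λ { (e , _) → av e }) s))
    where
    distrib : hit (H ⊕ pair p q) v ≼ hit H v ⊕ pair p q
    distrib (inj₁ e , v∉) = inj₁ (e , v∉) , λ _ u∈ → u∈
    distrib (inj₂ _ , v∉) = inj₂ tt , λ _ u∈ → u∈
  SWin-pair {H} {k} av s@(reply d f) = reply (DWin-pair av d) respond
    where
    respond : ∀ v → DWin (cut (H ⊕ pair p q) v) (suc k)
    respond v with v ≟ p | v ≟ q
    ... | yes refl | _ = move q (SWin-mono to-H s)
      where
      to-H : hit (cut (H ⊕ pair p q) p) q ≼ H
      to-H (inj₁ e , _) = e , λ { u u∈ → u∈ , λ { refl → proj₁ (av e) u∈ } }
      to-H (inj₂ _ , q∉) = ⊥-elim (q∉ (inj₂ refl , p≢q ∘ ≡-sym))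
    ... | no _ | yes refl = move p (SWin-mono to-H s)
      where
      to-H : hit (cut (H ⊕ pair p q) q) p ≼ H
      to-H (inj₁ e , _) = e , λ { u u∈ → u∈ , λ { refl → proj₂ (av e) u∈ } }
      to-H (inj₂ _ , p∉) = ⊥-elim (p∉ (inj₁ refl , p≢q))
    ... | no v≢p | no v≢q =
      DWin-mono distrib (DWin-pair (λ e → proj₁ (av e) ∘ proj₁ , proj₂ (av e) ∘ proj₁) (f v))
      where
      distrib : cut (H ⊕ pair p q) v ≼ cut H v ⊕ pair p q
      distrib (inj₁ e) = inj₁ e , λ _ u∈ → u∈
      distrib (inj₂ _) = inj₂ tt , λ { u (inj₁ refl) → inj₁ refl , v≢p ∘ ≡-sym
                                        ; u (inj₂ refl) → inj₂ refl , v≢q ∘ ≡-sym }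

-- Translation between the graph game and the hypergraph game.

module _ (G : Graph n) where

  Near : Fin n → Fin n → Set
  Near u v = u ≡ v ⊎ adj G u v ≡ true

  near? : ∀ u v → Dec (Near u v)
  near? u v = u ≟ v ⊎-dec adj G u v Bool.≟ true

  near-sym : ∀ {u v} → Near u v → Near v u
  near-sym (inj₁ u≡v) = inj₁ (≡-sym u≡v)
  near-sym {u} {v} (inj₂ uv) = inj₂ (trans (sym G v u) uv)

module _ (G : Graph n) (S : VSet n) where
  open Game G S

  Dominated : VSet n → Fin n → Set
  Dominated D v = ∃[ u ] S u ≡ true × D u ≡ true × Near G u v

  -- A vertex of `S` taken by Dominator lies in no edge, because the edges belong to vertices that
  -- are still undominated.
  position : VSet n → VSet n → Hypergraph (Fin n)
  position D St .Edge = ∃[ v ] S v ≡ true × ¬ Dominated D v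
  position D St ._∋_ (v , _) u = (S u ≡ true × Near G u v) × St u ≡ false

  private variable
    D St : VSet n
    u v : Fin n

  free⇒∉St : Free D St v → St v ≡ false
  free⇒∉St {D = D} {St = St} {v = v} free with S v | D v | St v
  free⇒∉St refl | true | false | false = refl

  free? : ∀ D St v → Dec (Free D St v)
  free? D St v = _ Bool.≟ true

  edge-free : ∀ e → (position D St ∋ e) v → Free D St v
  edge-free {D = D} {St = St} {v = v} (w , Sw , undom) ((Sv , near) , Stv) with D v in Dv
  ... | true  = ⊥-elim (undom (v , Sv , Dv , near))
  ... | false rewrite Sv | Stv = refl

  add-self : ∀ (D : VSet n) v → add D v v ≡ true
  add-self D v with D v | v ≟ v
  ... | true  | _       = refl
  ... | false | yes _   = refl
  ... | false | no v≢v  = ⊥-elim (v≢v refl)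

  add-⊇ : ∀ (D : VSet n) v → D u ≡ true → add D v u ≡ true
  add-⊇ D v Du rewrite Du = refl

  add-inv : ∀ (D : VSet n) v u → add D v u ≡ true → D u ≡ true ⊎ u ≡ v
  add-inv D v u h with D u | u ≟ v
  ... | true  | _ = inj₁ refl
  ... | false | yes u≡v = inj₂ u≡v
  add-inv D v u () | false | no _

  add-false : ∀ (D : VSet n) v → D u ≡ false → u ≢ v → add D v u ≡ false
  add-false {u} D v Du u≢v rewrite Du with u ≟ v
  ... | yes u≡v = ⊥-elim (u≢v u≡v)
  ... | no _ = refl

  add-false⁻ : ∀ (D : VSet n) v u → add D v u ≡ false → D u ≡ false × u ≢ v
  add-false⁻ D v u h with D u | u ≟ v
  ... | false | no u≢v = refl , u≢v
  add-false⁻ D v u () | true | _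
  add-false⁻ D v u () | false | yes _

  hit≼add : Free D St v → hit (position D St) v ≼ position (add D v) St
  hit≼add {D = D} {St = St} {v = v} free ((w , Sw , undom) , v∉) = (w , Sw , undom′) , λ _ u∈ → u∈
    where
    undom′ : ¬ Dominated (add D v) w
    undom′ (u , Su , Du , near) with add-inv D v u Du
    ... | inj₁ Du′  = undom (u , Su , Du′ , near)
    ... | inj₂ refl = v∉ ((Su , near) , free⇒∉St {D = D} {St = St} free)

  add≼ : ∀ D St v → position (add D v) St ≼ position D St
  add≼ D St v (w , Sw , undom) =
    (w , Sw , λ { (u , Su , Du , near) → undom (u , Su , add-⊇ D v Du , near) }) , λ _ u∈ → u∈

  add≼hit : ∀ D St v → position (add D v) St ≼ hit (position D St) v
  add≼hit D St v e@(w , Sw , undom) =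
    (proj₁ (add≼ D St v e) , λ { ((Sv , near) , _) → undom (v , Sv , add-self D v , near) }) , λ _ u∈ → u∈

  cut≼add : ∀ D St v → cut (position D St) v ≼ position D (add St v)
  cut≼add D St v (w , Sw , undom) = (w , Sw , undom) , λ { u (Su-near , Stu) →
    (Su-near , proj₁ (add-false⁻ St v u Stu)) , proj₂ (add-false⁻ St v u Stu) }

  add≼cut : ∀ D St v → position D (add St v) ≼ cut (position D St) v
  add≼cut D St v (w , Sw , undom) = (w , Sw , undom) , λ { u ((Su-near , Stu) , u≢v) →
    Su-near , add-false St v Stu u≢v }

  ≼hit-idle : ¬ Free D St v → position D St ≼ hit (position D St) v
  ≼hit-idle {D = D} {St = St} ¬free e = (e , λ v∈ → ¬free (edge-free {D = D} {St = St} e v∈)) , λ _ u∈ → u∈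

  cut-idle≼ : ¬ Free D St v → cut (position D St) v ≼ position D St
  cut-idle≼ {D = D} {St = St} ¬free e = e , λ { u u∈ → u∈ , λ { refl → ¬free (edge-free {D = D} {St = St} e u∈) } }

  toDWin : WinD k D St → DWin (position D St) k
  toSWin : WinS k D St → SWin (position D St) k
  toDWin (doneD dom) = done λ { (v , Sv , undom) → undom (dom v Sv) }
  toDWin {D = D} {St} (moveD v free w) = move v (SWin-mono (hit≼add {D = D} {St = St} free) (toSWin w))
  toSWin (doneS dom) = done-SWin λ { (v , Sv , undom) → undom (dom v Sv) }
  toSWin {k} {D = D} {St = St} (moveS (u , u-free) w) = reply pass respond
    where
    -- A pass helps Staller no more than taking the free vertex `u`, which only shrinks edges.
    pass : DWin (position D St) k
    pass = DWin-mono (≼-cut {H = position D St} u) (DWin-mono (cut≼add D St u) (toDWin (w u u-free)))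
    respond : ∀ v → DWin (cut (position D St) v) k
    respond v with free? D St v
    ... | yes free = DWin-mono (cut≼add D St v) (toDWin (w v free))
    ... | no ¬free = DWin-mono (cut-idle≼ {D = D} {St = St} ¬free) pass

  dominated? : ∀ D v → Dec (Dominated D v)
  dominated? D v = any? λ u → S u Bool.≟ true ×-dec D u Bool.≟ true ×-dec near? G u v

  dominates? : ∀ D St → Dominates D ⊎ Edge (position D St)
  dominates? D St with any? (λ v → S v Bool.≟ true ×-dec ¬? (dominated? D v))
  ... | yes e = inj₂ e
  ... | no ∄e = inj₁ λ v Sv → decidable-stable (dominated? D v) λ undom → ∄e (v , Sv , undom)

  -- Without a free vertex the undominated vertex would give an empty edge, and Dominator would have
  -- lost.
  free-vertex : Edge (position D St) → DWin (position D St) k → ∃[ v ] Free D St v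
  free-vertex {D = D} {St = St} e@(w , _) d with any? (free? D St)
  ... | yes free = free
  ... | no ∄free = ⊥-elim (lost e (λ u u∈ → ∄free (u , edge-free {D = D} {St = St} e u∈)) d)

  fromDWin : ∀ k {D St} → DWin (position D St) k → WinD k D St
  fromSWin : ∀ k {D St} → SWin (position D St) k → WinS k D St
  fromDWin k {D = D} {St = St} (done ∄e) with dominates? D St
  ... | inj₁ dom = doneD dom
  ... | inj₂ e   = ⊥-elim (∄e e)
  fromDWin (suc k) {D = D} {St = St} d@(move v s) with dominates? D St
  ... | inj₁ dom = doneD dom
  ... | inj₂ e with free? D St v
  ...   | yes free = moveD v free (fromSWin k (SWin-mono (add≼hit D St v) s))
  -- The move `v` meets no edge, so any free vertex can replace it.
  ...   | no ¬free with free-vertex {D = D} {St = St} e d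
  ...     | u , free = moveD u free (fromSWin k (SWin-mono (λ e′ →
    let e″ , ⊆e = add≼ D St u e′ in proj₁ (≼hit-idle {D = D} {St = St} ¬free e″) , ⊆e) s))
  fromSWin k {D = D} {St = St} s with dominates? D St
  ... | inj₁ dom = doneS dom
  ... | inj₂ e   = moveS (free-vertex {D = D} {St = St} e (SWin⇒DWin s)) λ v _ →
    fromDWin k (DWin-mono (add≼cut D St v) (answer s v))

-- Vertex sets and their cardinalities.

true≢false : ∀ {b} → b ≡ true → b ≢ false
true≢false refl ()

apart : ∀ {S : VSet n} {u v} → S u ≡ true → S v ≡ false → u ≢ v
apart Su Sv refl = true≢false Su Sv

delete : VSet n → Fin n → VSet n
delete P v u = P u ∧ not ⌊ u ≟ v ⌋

delete⁺ : ∀ (P : VSet n) {v u} → P u ≡ true → u ≢ v → delete P v u ≡ true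
delete⁺ P {v} {u} Pu u≢v with u ≟ v
... | yes u≡v = ⊥-elim (u≢v u≡v)
... | no _ rewrite Pu = refl

delete⁻ : ∀ (P : VSet n) {v u} → delete P v u ≡ true → P u ≡ true × u ≢ v
delete⁻ P {v} {u} h with P u | u ≟ v
delete⁻ P refl | true | no u≢v = refl , u≢v
delete⁻ P () | true | yes _
delete⁻ P () | false | _

card-cong : ∀ {P Q : VSet n} → P ≗ Q → card P ≡ card Q
card-cong {zero}  P≗Q = refl
card-cong {suc n} P≗Q rewrite P≗Q zero = cong (_ +_) (card-cong (P≗Q ∘ suc))

card-delete : ∀ (P : VSet n) v → P v ≡ true → card P ≡ suc (card (delete P v))
card-delete P zero Pv rewrite Pv = cong suc (card-cong λ i → ≡-sym (∧-identityʳ (P (suc i))))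
card-delete P (suc v) Pv rewrite ∧-identityʳ (P zero) | card-delete (P ∘ suc) v Pv =
  trans (cong (λ c → (if P zero then 1 else 0) + suc c) 
           (card-cong λ i → cong (λ b → P (suc i) ∧ not b) (⌊≟⌋-suc i)))
        (+-suc (if P zero then 1 else 0) _)
  where
  ⌊≟⌋-suc : ∀ i → ⌊ i ≟ v ⌋ ≡ ⌊ suc i ≟ suc v ⌋
  ⌊≟⌋-suc i = trans (isYes≗does (i ≟ v)) (≡-sym (isYes≗does (suc i ≟ suc v)))

card-full : ∀ n → card {n} full ≡ n
card-full zero    = refl
card-full (suc n) = cong suc (card-full n)

card-zero : ∀ (P : VSet n) → card P ≡ 0 → ∀ u → P u ≢ true
card-zero P |P| u Pu with () ← trans (≡-sym |P|) (card-delete P u Pu)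

card-suc : ∀ (P : VSet n) {k} → card P ≡ suc k → ∃[ u ] P u ≡ true
card-suc {suc n} P |P| with P zero in P0
... | true  = zero , P0
... | false with card-suc (P ∘ suc) |P|
...   | u , Pu = suc u , Pu

card-one : ∀ (P : VSet n) {v} → card P ≡ 1 → P v ≡ true → ∀ u → P u ≡ true → u ≡ v
card-one P {v} |P| Pv u Pu with u ≟ v
... | yes u≡v = u≡v
... | no u≢v  = ⊥-elim (card-zero (delete P v)
  (suc-injective (trans (≡-sym (card-delete P v Pv)) |P|)) u (delete⁺ P Pu u≢v))

card-two : ∀ (P : VSet n) {v} → card P ≡ 2 → P v ≡ true →
           ∃[ w ] P w ≡ true × w ≢ v × (∀ u → P u ≡ true → u ≡ v ⊎ u ≡ w)
card-two P {v} |P| Pv with suc-injective (trans (≡-sym (card-delete P v Pv)) |P|)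
... | one with card-suc (delete P v) one
...   | w , Pw with delete⁻ P Pw
...     | Pw′ , w≢v = w , Pw′ , w≢v , λ u Pu → case-v u Pu
  where
  case-v : ∀ u → P u ≡ true → u ≡ v ⊎ u ≡ w
  case-v u Pu with u ≟ v
  ... | yes u≡v = inj₁ u≡v
  ... | no u≢v  = inj₂ (card-one (delete P v) one Pw u (delete⁺ P Pu u≢v))

∧-true : ∀ {a b} → a ≡ true → b ≡ true → a ∧ b ≡ true
∧-true refl refl = refl

∧-true⁻ : ∀ a {b} → a ∧ b ≡ true → a ≡ true × b ≡ true
∧-true⁻ true b≡true = refl , b≡true

-- Pendant pairs and their removal.

module _ (G : Graph n) where

  -- Common to both kinds of step: inside `S` the closed neighbourhood of `x` lies in `{x, y}`,
  -- which makes Staller's move on `y` a threat.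
  record Removal (S T : VSet n) : Set where
    field
      x y  : Fin n
      x∈   : S x ≡ true
      y∈   : S y ≡ true
      x~y  : adj G x y ≡ true
      leaf : ∀ {u} → S u ≡ true → Near G u x → u ≡ x ⊎ u ≡ y
      T-eq : T ≗ delete (delete S x) y

    x≢y : x ≢ y
    x≢y x≡y = true≢false x~y (trans (cong (adj G x) (≡-sym x≡y)) (irrefl G x))

    T⁻ : ∀ {v} → T v ≡ true → S v ≡ true × v ≢ x × v ≢ y
    T⁻ {v} Tv with delete⁻ (delete S x) (trans (≡-sym (T-eq v)) Tv)
    ... | Sv′ , v≢y with delete⁻ S Sv′
    ...   | Sv , v≢x = Sv , v≢x , v≢y

    T⁺ : ∀ {v} → S v ≡ true → v ≢ x → v ≢ y → T v ≡ true
    T⁺ {v} Sv v≢x v≢y = trans (T-eq v) (delete⁺ (delete S x) (delete⁺ S Sv v≢x) v≢y)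

    ∉T : ∀ {v} → S v ≡ false → T v ≡ false
    ∉T {v} Sv with T v in Tv
    ... | false = refl
    ... | true  = ⊥-elim (true≢false (proj₁ (T⁻ Tv)) Sv)

    x∉T : T x ≡ false
    x∉T with T x in Tx
    ... | false = refl
    ... | true  = ⊥-elim (proj₁ (proj₂ (T⁻ Tx)) refl)

    y∉T : T y ≡ false
    y∉T with T y in Ty
    ... | false = refl
    ... | true  = ⊥-elim (proj₂ (proj₂ (T⁻ Ty)) refl)

    card-removal : card S ≡ 2 + card T
    card-removal = trans (card-delete S x x∈) (cong suc (trans
      (card-delete (delete S x) y (delete⁺ S y∈ (x≢y ∘ ≡-sym)))
      (cong suc (card-cong (≡-sym ∘ T-eq)))))

    far : ∀ {v} → T v ≡ true → ¬ Near G x v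
    far Tv near with T⁻ Tv
    ... | Sv , v≢x , v≢y = [ v≢x , v≢y ]′ (leaf Sv (near-sym G near))

  record Attached {S T} (r : Removal S T) : Set where
    open Removal r
    field
      z     : Fin n
      z∈    : T z ≡ true
      inner : ∀ {u} → S u ≡ true → Near G u y → u ≡ x ⊎ u ≡ y ⊎ u ≡ z

    far-y : ∀ {v} → T v ≡ true → v ≢ z → ¬ Near G y v
    far-y Tv v≢z near with T⁻ Tv
    ... | Sv , v≢x , v≢y = [ v≢x , [ v≢y , v≢z ]′ ]′ (inner Sv (near-sym G near))

  removal : ∀ {S T} → Step G S T → Σ[ r ∈ Removal S T ] (Attached r ⊎ (∀ v → T v ≡ false))
  removal {S} {T} (pendant x y x∈ y∈ x~y deg-x deg-y T-eq) = r , inj₁ attached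
    where
    r : Removal S T
    r = record
      { x = x ; y = y ; x∈ = x∈ ; y∈ = y∈ ; x~y = x~y
      ; leaf = λ { {u} Su (inj₁ u≡x) → inj₁ u≡x
                 ; {u} Su (inj₂ ux) → inj₂ (card-one _ deg-x (∧-true y∈ x~y) u
                                                (∧-true Su (trans (sym G x u) ux))) }
      ; T-eq = λ v → trans (T-eq v) (≡-sym (∧-assoc (S v) _ _)) }
    attached : Attached r
    attached with card-two _ deg-y (∧-true x∈ (trans (sym G y x) x~y))
    ... | z , yz , z≢x , nbrs with ∧-true⁻ (S z) yz
    ...   | Sz , y~z = record
      { z = z
      ; z∈ = Removal.T⁺ r Sz z≢x λ { refl → true≢false y~z (irrefl G y) }
      ; inner = λ { {u} Su (inj₁ u≡y) → inj₂ (inj₁ u≡y)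
                  ; {u} Su (inj₂ uy) → [ inj₁ , inj₂ ∘ inj₂ ]′ (nbrs u (∧-true Su (trans (sym G y u) uy))) } }
  removal {S} {T} (wholeP2 x y x∈ y∈ x~y S⊆ T-empty) = record
    { x = x ; y = y ; x∈ = x∈ ; y∈ = y∈ ; x~y = x~y
    ; leaf = λ {u} Su _ → S⊆ u Su
    ; T-eq = λ v → trans (T-empty v) (≡-sym (gone v)) } , inj₂ T-empty
    where
    gone : ∀ v → delete (delete S x) y v ≡ false
    gone v with delete (delete S x) y v in eq
    ... | false = refl
    ... | true with delete⁻ (delete S x) eq
    ...   | Sv′ , v≢y with delete⁻ S Sv′
    ...     | Sv , v≢x = ⊥-elim ([ v≢x , v≢y ]′ (S⊆ v Sv))

  steps : ∀ {S R} → Star (Step G) S R → ℕ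
  steps ε        = 0
  steps (_ ◅ ss) = suc (steps ss)

  -- The closed neighbourhoods, within S, of the vertices in P that still have to be
  -- dominated; X lists the neighbours that a vertex has outside S.
  nbhds : VSet n → (Fin n → Set) → (Fin n → Fin n → Set) → Hypergraph (Fin n)
  nbhds S P X .Edge = ∃[ v ] S v ≡ true × P v
  nbhds S P X ._∋_ (v , _) u = (S u ≡ true × Near G u v) ⊎ X v u

  None : Fin n → Fin n → Set
  None _ _ = ⊥

  closed : VSet n → Hypergraph (Fin n)
  closed S = nbhds S (λ _ → ⊤) None

  -- Stripping off a pair by a forced round.

  module _ {S T} (r : Removal S T) where
    open Removal r

    -- No vertex of `T` is adjacent to `x`, so the edges belonging to `T` survive Dominator's `x`
    -- and lose at most Staller's `y`.
    peel-≼ : ∀ {P P′ X} → (∀ {v} → T v ≡ true → P v → P′ v) → (∀ v → T v ≡ true → ¬ X v x) →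
             nbhds T P X ≼ hit (cut (nbhds S P′ X) y) x
    peel-≼ P⊆ X-x (v , Tv , Pv) =
      ((v , proj₁ (T⁻ Tv) , P⊆ Tv Pv) , λ { (inj₁ (_ , near) , _) → far Tv near
                                          ; (inj₂ Xvx , _) → X-x v Tv Xvx }) ,
      λ { u (inj₁ (Su , near) , u≢y) → inj₁ (T⁺ Su (λ { refl → far Tv near }) u≢y , near)
        ; u (inj₂ Xvu , _) → inj₂ Xvu }

    leaf-edge : ∀ {P X} (Px : P x) → (∀ u → ¬ X x u) → ∀ u →
                (nbhds S P X ∋ (x , x∈ , Px)) u → u ≡ y ⊎ u ≡ x
    leaf-edge Px ∄X u (inj₁ (Su , near)) = swap (leaf Su near)
    leaf-edge Px ∄X u (inj₂ Xxu) = ⊥-elim (∄X u Xxu)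

    peel : ∀ {P P′ X k} → (∀ {v} → T v ≡ true → P v → P′ v) → P′ x → (∀ u → ¬ X x u) →
           (∀ v → T v ≡ true → ¬ X v x) → SWin (nbhds S P′ X) k → Spent k (nbhds T P X)
    peel {P} {P′} {X} P⊆ Px ∄X X-x =
      exchange (x , x∈ , Px) y x (leaf-edge {P′} {X} Px ∄X) (peel-≼ {P} {P′} {X} P⊆ X-x)

    peel-⊕ : ∀ {P X K k} → P x → (∀ u → ¬ X x u) → (∀ v → T v ≡ true → ¬ X v x) → (∀ e → ¬ (K ∋ e) x) →
             SWin (nbhds S P X ⊕ K) k → Spent k (nbhds T P X ⊕ K)
    peel-⊕ {P} {X} {K} Px ∄X X-x K-x = exchange (inj₁ (x , x∈ , Px)) y x (leaf-edge {P} {X} Px ∄X) ≼K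
      where
      ≼K : nbhds T P X ⊕ K ≼ hit (cut (nbhds S P X ⊕ K) y) x
      ≼K (inj₁ e) with peel-≼ {P} {P} {X} (λ _ Pv → Pv) X-x e
      ... | (e′ , x∉) , ⊆e = (inj₁ e′ , x∉) , ⊆e
      ≼K (inj₂ e) = (inj₂ e , K-x e ∘ proj₁) , λ _ → proj₁

  -- The S-game and the upper bound in the D-game.

  module _ {S T} (r : Removal S T) where
    open Removal r

    -- The neighbourhoods of `x` and of `y` both contain `{x, y}`, so hitting this one pair takes
    -- care of both.
    closed-≼-⊕ : closed S ≼ closed T ⊕ pair x y
    closed-≼-⊕ (v , Sv , _) with v ≟ x | v ≟ y
    ... | yes refl | _ = inj₂ tt , λ
      { u (inj₁ refl) → inj₁ (x∈ , inj₁ refl)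
      ; u (inj₂ refl) → inj₁ (y∈ , inj₂ (trans (sym G y x) x~y)) }
    ... | no _ | yes refl = inj₂ tt , λ
      { u (inj₁ refl) → inj₁ (x∈ , inj₂ x~y)
      ; u (inj₂ refl) → inj₁ (y∈ , inj₁ refl) }
    ... | no v≢x | no v≢y =
      inj₁ (v , T⁺ Sv v≢x v≢y , tt) , λ { u (inj₁ (Tu , near)) → inj₁ (proj₁ (T⁻ Tu) , near) }

    closed-avoids : Avoids x≢y (closed T)
    closed-avoids e = (λ { (inj₁ (Tx , _)) → true≢false Tx x∉T }) , λ { (inj₁ (Ty , _)) → true≢false Ty y∉T }

  card-steps : ∀ {S R} (ss : Star (Step G) S R) → card S ≡ steps ss + steps ss + card R
  card-steps ε = refl
  card-steps (s ◅ ss)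
    rewrite Removal.card-removal (proj₁ (removal s)) | card-steps ss | +-suc (steps ss) (steps ss) = refl

  DWin-steps : ∀ {S R k} (ss : Star (Step G) S R) → DWin (closed R) k → DWin (closed S) (steps ss + k)
  DWin-steps ε d = d
  DWin-steps (s ◅ ss) d with removal s
  ... | r , _ = DWin-mono (closed-≼-⊕ r) (DWin-pair (Removal.x≢y r) (closed-avoids r) (DWin-steps ss d))

  SWin-steps : ∀ {S R k} (ss : Star (Step G) S R) → SWin (closed R) k → SWin (closed S) (steps ss + k)
  SWin-steps ε d = d
  SWin-steps (s ◅ ss) d with removal s
  ... | r , _ = SWin-mono (closed-≼-⊕ r) (SWin-pair (Removal.x≢y r) (closed-avoids r) (SWin-steps ss d))

  -- Staller strips off the pairs in their order of removal; every round costs Dominator one move.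
  SWin-steps⁻ : ∀ {S R k} (ss : Star (Step G) S R) → SWin (closed S) k →
                ∃[ j ] k ≡ steps ss + j × SWin (closed R) j
  SWin-steps⁻ ε w = _ , refl , w
  SWin-steps⁻ (s ◅ ss) w with removal s
  ... | r , _ with peel r {P = λ _ → ⊤} (λ _ _ → tt) tt (λ _ ()) (λ _ _ ()) w
  ...   | _ , refl , w′ with SWin-steps⁻ ss w′
  ...     | j , refl , w″ = j , refl , w″

  -- The lower bound in the D-game.

  -- Dominator's budget b on the whole graph pays for m removed pairs and a win on R.
  Budget : ℕ → ℕ → VSet n → Set
  Budget b m R = ∃[ j ] m + j ≤ b × DWin (closed R) j

  weaken : ∀ {a b m R} → a ≤ b → Budget a m R → Budget b m R
  weaken a≤b (j , h , d) = j , ≤-trans h a≤b , d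

  suc-budget : ∀ {b m R} → Budget b m R → Budget (suc b) (suc m) R
  suc-budget (j , h , d) = j , s≤s h , d

  -- No pair can be removed from an empty set, so `R` is empty too and Dominator needs `j = 0` moves
  -- there.
  emptied : ∀ {T R b} m → (∀ v → T v ≡ false) → (ss : Star (Step G) T R) → m ≤ b →
            Budget b (m + steps ss) R
  emptied {b = b} m T-empty ε m≤b =
    0 , subst (_≤ b) (≡-sym (trans (+-identityʳ _) (+-identityʳ m))) m≤b ,
    done λ { (v , Tv , _) → true≢false Tv (T-empty v) }
  emptied m T-empty (s ◅ _) _ with removal s
  ... | r , _ = ⊥-elim (true≢false (Removal.x∈ r) (T-empty _))

  Predominated : VSet n → Fin n → Hypergraph (Fin n)
  Predominated S w = nbhds S (_≢ w) None

  -- A path a b w hangs at w, with a already dominated.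
  Tailed : VSet n → Fin n → Fin n → Fin n → Hypergraph (Fin n)
  Tailed S w a b = nbhds S (λ _ → ⊤) (λ v u → v ≡ w × u ≡ b) ⊕ ⟪ (λ u → u ≡ a ⊎ u ≡ b ⊎ u ≡ w) ⟫

  -- A leaf ℓ hangs at w; the neighbourhood of w contains {ℓ, w} and is left out.
  Leafed : VSet n → Fin n → Fin n → Hypergraph (Fin n)
  Leafed S w ℓ = Predominated S w ⊕ pair ℓ w

  all-forced : ∀ {S R k} (ss : Star (Step G) S R) → SWin (closed S) k → Budget k (steps ss) R
  all-forced ss w with SWin-steps⁻ ss w
  ... | j , refl , w′ = j , ≤-refl , SWin⇒DWin w′

  -- The edge `{ℓ, w}` still costs Dominator a move, so the bound is `k`, with no gain. Induction on
  -- the removed pairs, by the place of `w` in the next one.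
  budget-Leafed : ∀ {S R w ℓ k} (ss : Star (Step G) S R) → S w ≡ true → S ℓ ≡ false →
              SWin (Leafed S w ℓ) k → Budget k (steps ss) R
  budget-Leafed {R = R} {w} {ℓ} ε w∈ ℓ∉ win
    -- Staller takes `ℓ`; the forced answer `w` serves as Dominator's opening move on `R`.
    with exchange {K = hit (closed R) w} (inj₂ tt) ℓ w (λ _ → id) ≼Leafed win
    where
    ≼Leafed : hit (closed R) w ≼ hit (cut (Leafed R w ℓ) ℓ) w
    ≼Leafed ((v , Rv , _) , w∉) = 
      (inj₁ (v , Rv , λ { refl → w∉ (inj₁ (w∈ , inj₁ refl)) }) , w∉ ∘ proj₁) , λ _ → proj₁
  ... | j , refl , win′ = suc j , ≤-refl , move w win′
  budget-Leafed {S} {w = w} {ℓ} (_◅_ {j = T} s ss) w∈ ℓ∉ win with removal s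
  ... | r , inj₂ T-empty with positive (inj₂ tt) win
  ...   | _ , refl = emptied 1 T-empty ss (s≤s z≤n)
  budget-Leafed {S} {w = w} {ℓ} (_◅_ {j = T} s ss) w∈ ℓ∉ win | r , inj₁ att with w ≟ Removal.x r | w ≟ Removal.y r
  ... | yes refl | _ = case-x
    where
    open Removal r
    open Attached att
    -- On the path `ℓ x y z` Staller's `x` forces `ℓ`. Now only `y` and `z` can dominate `y`, which
    -- becomes the leaf at `z`.
    ≼Leafed : Leafed T z y ≼ hit (cut (Leafed S x ℓ) x) ℓ
    ≼Leafed (inj₁ (v , Tv , v≢z)) =
      (inj₁ (v , proj₁ (T⁻ Tv) , proj₁ (proj₂ (T⁻ Tv))) ,
        λ { (inj₁ (Sℓ , _) , _) → true≢false Sℓ ℓ∉ }) ,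
      λ { u (inj₁ (Su , near) , u≢x) → inj₁ (T⁺ Su u≢x (λ { refl → far-y Tv v≢z near }) , near) }
    ≼Leafed (inj₂ _) =
      (inj₁ (y , y∈ , x≢y ∘ ≡-sym) , λ { (inj₁ (Sℓ , _) , _) → true≢false Sℓ ℓ∉ }) ,
      λ { u (inj₁ (Su , near) , u≢x) → [ (λ u≡x → contradiction u≡x u≢x) , id ]′ (inner Su near) }
    case-x : Budget _ _ _
    case-x with exchange {K = Leafed T z y} (inj₂ tt) x ℓ (λ _ → swap) ≼Leafed win
    ... | j , refl , win′ = suc-budget (budget-Leafed ss z∈ y∉T win′)
  -- Two leaves `ℓ` and `x` hang at `y`, so Staller's `y` threatens both.
  ... | no _ | yes refl = ⊥-elim (double-threat (inj₂ tt) (inj₁ (x , x∈ , x≢y)) ℓ y x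
      (λ { refl → true≢false x∈ ℓ∉ }) (λ _ → id) (λ { u (inj₁ (Su , near)) → swap (leaf Su near) }) win)
    where open Removal r
  ... | no w≢x | no w≢y with peel-⊕ r (w≢x ∘ ≡-sym) (λ _ ()) (λ _ _ ())
                               (λ { _ → [ apart x∈ ℓ∉ , w≢x ∘ ≡-sym ]′ }) win
    where open Removal r
  ...   | j , refl , win′ = suc-budget (budget-Leafed ss (Removal.T⁺ r w∈ w≢x w≢y) (Removal.∉T r ℓ∉) win′)

  -- The `suc` in the budget is the one move that Dominator may have gained.
  budget-Predominated : ∀ {S R w k} (ss : Star (Step G) S R) → S w ≡ true →
              SWin (Predominated S w) k → Budget (suc k) (steps ss) R
  -- The other `suc` counts the tail `a b` as a removed pair that is not yet paid for.
  budget-Tailed : ∀ {S R w a b k} (ss : Star (Step G) S R) → S w ≡ true → S a ≡ false → S b ≡ false →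
              SWin (Tailed S w a b) k → Budget (suc k) (suc (steps ss)) R

  -- The gained move pays for opening on `R` with `w`, which in particular dominates `w`.
  budget-Predominated {R = R} {w} ε w∈ win = _ , ≤-refl , move w (SWin-mono ≼Predominated win)
    where
    ≼Predominated : hit (closed R) w ≼ Predominated R w
    ≼Predominated ((v , Rv , _) , w∉) = (v , Rv , λ { refl → w∉ (inj₁ (w∈ , inj₁ refl)) }) , λ _ → id
  budget-Predominated {S} {w = w} (_◅_ {j = T} s ss) w∈ win with removal s
  ... | r , inj₂ T-empty = emptied 1 T-empty ss (s≤s z≤n)
  ... | r , inj₁ att with w ≟ Removal.x r | w ≟ Removal.y r
  -- No move is played: as `x` is already dominated, the pair becomes the tail at `z`.
  ...   | yes refl | _ = budget-Tailed ss z∈ x∉T y∉T (SWin-mono ≼Predominated win)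
    where
    open Removal r
    open Attached att
    ≼Predominated : Tailed T z x y ≼ Predominated S x
    ≼Predominated (inj₁ (v , Tv , _)) =
      (v , proj₁ (T⁻ Tv) , proj₁ (proj₂ (T⁻ Tv))) , λ { u (inj₁ (Su , near)) → inside u Su near }
      where
      inside : ∀ u → S u ≡ true → Near G u v → (Tailed T z x y ∋ inj₁ (v , Tv , tt)) u
      inside u Su near with u ≟ y | v ≟ z
      ... | yes refl | yes v≡z = inj₂ (v≡z , refl)
      ... | yes refl | no v≢z  = ⊥-elim (far-y Tv v≢z near)
      ... | no u≢y   | _       = inj₁ (T⁺ Su (λ { refl → far Tv near }) u≢y , near)
    ≼Predominated (inj₂ _) = (y , y∈ , x≢y ∘ ≡-sym) , λ { u (inj₁ (Su , near)) → inner Su near }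
  ...   | no _ | yes refl = case-y
    where
    open Removal r
    case-y : Budget _ _ _
    -- The forced `x` dominates `y` anyway, so the advantage vanishes.
    case-y with peel r {P = λ _ → ⊤} (λ Tv _ → proj₂ (proj₂ (T⁻ Tv))) x≢y (λ _ ()) (λ _ _ ()) win
    ... | _ , refl , win′ = suc-budget (weaken (n≤1+n _) (all-forced ss win′))
  ...   | no w≢x | no w≢y with peel r {P = _≢ w} (λ _ p → p) (w≢x ∘ ≡-sym) (λ _ ()) (λ _ _ ()) win
  ...     | j , refl , win′ = suc-budget (budget-Predominated ss (Removal.T⁺ r w∈ w≢x w≢y) win′)

  -- Staller takes `b`, and Dominator moves first on `R` with all `k` moves left; the gained move
  -- pays for the tail.
  budget-Tailed {R = R} {w} {a} {b} {k} ε w∈ a∉ b∉ win = k , ≤-refl , DWin-mono ≼Tailed (answer win b)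
    where
    ≼Tailed : closed R ≼ cut (Tailed R w a b) b
    ≼Tailed (v , Rv , _) = inj₁ (v , Rv , tt) , λ
      { u (inj₁ u∈ , _) → inj₁ u∈
      ; u (inj₂ (_ , u≡b) , u≢b) → contradiction u≡b u≢b }
  budget-Tailed {S} {w = w} {a} {b} (_◅_ {j = T} s ss) w∈ a∉ b∉ win with removal s
  ... | r , inj₂ T-empty with positive (inj₂ tt) win
  ...   | _ , refl = emptied 2 T-empty ss (s≤s (s≤s z≤n))
  budget-Tailed {S} {w = w} {a} {b} (_◅_ {j = T} s ss) w∈ a∉ b∉ win | r , inj₁ att with w ≟ Removal.x r | w ≟ Removal.y r
  ... | yes refl | _ = case-x
    where
    open Removal r
    open Attached att
    -- After Staller's `x` the edges of the tail, of `x` and of `y` lie within `{a, b}`, `{b, y}`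
    -- and `{y, z}`, the chain that `path-reply` requires.
    J : Hypergraph (Fin n)
    J = cut (Tailed S x a b) x
    b-avoids : ∀ {v} (Sv : S v ≡ true) → v ≢ x → ¬ (J ∋ inj₁ (v , Sv , tt)) b
    b-avoids Sv v≢x (inj₁ (Sb , _) , _)   = true≢false Sb b∉
    b-avoids Sv v≢x (inj₂ (v≡x , _) , _) = v≢x v≡x
    inside : ∀ {v} (Tv : T v ≡ true) (v≢z : v ≢ z) → ∀ u →
             (J ∋ inj₁ (v , proj₁ (T⁻ Tv) , tt)) u → (Predominated T z ∋ (v , Tv , v≢z)) u
    inside Tv v≢z u (inj₁ (Su , near) , u≢x) = inj₁ (T⁺ Su u≢x (λ { refl → far-y Tv v≢z near }) , near)
    inside Tv v≢z u (inj₂ (v≡x , _) , _) = ⊥-elim (proj₁ (proj₂ (T⁻ Tv)) v≡x)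
    y-edge : ∀ u → (J ∋ inj₁ (y , y∈ , tt)) u → u ≡ y ⊎ u ≡ z
    y-edge u (inj₁ (Su , near) , u≢x) = [ (λ u≡x → contradiction u≡x u≢x) , id ]′ (inner Su near)
    y-edge u (inj₂ (y≡x , _) , _) = ⊥-elim (x≢y (≡-sym y≡x))
    x-edge : ∀ u → (J ∋ inj₁ (x , x∈ , tt)) u → u ≡ b ⊎ u ≡ y
    x-edge u (inj₁ (Su , near) , u≢x) = [ (λ u≡x → contradiction u≡x u≢x) , inj₂ ]′ (leaf Su near)
    x-edge u (inj₂ (_ , u≡b) , _) = inj₁ u≡b
    ab-edge : ∀ u → (J ∋ inj₂ tt) u → u ≡ a ⊎ u ≡ b
    ab-edge u (inj₁ u≡a , _) = inj₁ u≡a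
    ab-edge u (inj₂ (inj₁ u≡b) , _) = inj₂ u≡b
    ab-edge u (inj₂ (inj₂ u≡x) , u≢x) = contradiction u≡x u≢x
    ≼b : Leafed T z y ≼ hit J b
    ≼b (inj₁ (v , Tv , v≢z)) =
      (inj₁ (v , proj₁ (T⁻ Tv) , tt) , b-avoids (proj₁ (T⁻ Tv)) (proj₁ (proj₂ (T⁻ Tv)))) , inside Tv v≢z
    ≼b (inj₂ _) = (inj₁ (y , y∈ , tt) , b-avoids y∈ (x≢y ∘ ≡-sym)) , y-edge
    y∌ab : ¬ (J ∋ inj₂ tt) y
    y∌ab y∈e = [ apart y∈ a∉ , apart y∈ b∉ ]′ (ab-edge y y∈e)
    ≼y : Predominated T z ≼ hit (cut (hit J y) a) b
    ≼y (v , Tv , v≢z) =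
      ((inj₁ (v , proj₁ (T⁻ Tv) , tt) , y∉v) , b-avoids (proj₁ (T⁻ Tv)) (proj₁ (proj₂ (T⁻ Tv))) ∘ proj₁) ,
      λ u → inside Tv v≢z u ∘ proj₁
      where
      y∉v : ¬ (J ∋ inj₁ (v , proj₁ (T⁻ Tv) , tt)) y
      y∉v (inj₁ (_ , near) , _) = far-y Tv v≢z near
      y∉v (inj₂ (v≡x , _) , _) = proj₁ (proj₂ (T⁻ Tv)) v≡x
    case-x : Budget _ _ _
    case-x with path-reply (inj₂ tt) (inj₁ (x , x∈ , tt)) (inj₁ (y , y∈ , tt)) a b y z
                  (apart y∈ a∉ ∘ ≡-sym) (apart (proj₁ (T⁻ z∈)) a∉ ∘ ≡-sym) (apart (proj₁ (T⁻ z∈)) b∉ ∘ ≡-sym)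
                  ab-edge x-edge y-edge (answer win x)
    ... | inj₁ (_ , refl , win′) = suc-budget (suc-budget (budget-Leafed ss z∈ y∉T (SWin-mono ≼b win′)))
    -- After Dominator's `y`, Staller's `a` forces `b`: two moves have paid for two pairs.
    ... | inj₂ (_ , refl , win′) with exchange {K = Predominated T z} (inj₂ tt , y∌ab) a b ab-edge ≼y win′
    ...   | _ , refl , win″ = suc-budget (suc-budget (budget-Predominated ss z∈ win″))
  ... | no _ | yes refl = case-y
    where
    open Removal r
    J : Hypergraph (Fin n)
    J = hit (cut (Tailed S y a b) y) x
    ab-edge : ∀ u → (cut (Tailed S y a b) y ∋ inj₂ tt) u → u ≡ a ⊎ u ≡ b
    ab-edge u (inj₁ u≡a , _) = inj₁ u≡a
    ab-edge u (inj₂ (inj₁ u≡b) , _) = inj₂ u≡b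
    ab-edge u (inj₂ (inj₂ u≡y) , u≢y) = contradiction u≡y u≢y
    leaf′ : ∀ u → (Tailed S y a b ∋ inj₁ (x , x∈ , tt)) u → u ≡ y ⊎ u ≡ x
    leaf′ u (inj₁ (Su , near)) = swap (leaf Su near)
    leaf′ u (inj₂ (x≡y , _)) = ⊥-elim (x≢y x≡y)
    ≼T : closed T ≼ hit (cut J a) b
    ≼T (v , Tv , _) with T⁻ Tv
    ... | Sv , v≢x , v≢y =
      ((inj₁ (v , Sv , tt) ,
        λ { (inj₁ (_ , near) , _) → far Tv near ; (inj₂ (v≡y , _) , _) → v≢y v≡y }) ,
        λ { ((inj₁ (Sb , _) , _) , _) → true≢false Sb b∉ ; ((inj₂ (v≡y , _) , _) , _) → v≢y v≡y }) ,
      λ { u ((inj₁ (Su , near) , u≢y) , _) → inj₁ (T⁺ Su (λ { refl → far Tv near }) u≢y , near)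
        ; u ((inj₂ (v≡y , _) , _) , _) → ⊥-elim (v≢y v≡y) }
    case-y : Budget _ _ _
    -- Two forced rounds, `y` against `x` and `a` against `b`, remove the pair and the tail.
    case-y with exchange {K = J} (inj₁ (x , x∈ , tt)) y x leaf′ (λ e → e , λ _ → id) win
    ... | _ , refl , win′
      with exchange {K = closed T}
             (inj₂ tt , λ x∈e → [ apart x∈ a∉ , apart x∈ b∉ ]′ (ab-edge x x∈e)) a b ab-edge ≼T win′
    ...   | _ , refl , win″ = suc-budget (suc-budget (weaken (n≤1+n _) (all-forced ss win″)))
  ... | no w≢x | no w≢y with peel-⊕ r tt (λ { _ (x≡w , _) → w≢x (≡-sym x≡w) }) (λ { _ _ (_ , x≡b) → apart x∈ b∉ x≡b })
                               (λ { _ → [ apart x∈ a∉ , [ apart x∈ b∉ , w≢x ∘ ≡-sym ]′ ]′ }) win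
    where open Removal r
  ...   | _ , refl , win′ = suc-budget
    (budget-Tailed ss (Removal.T⁺ r w∈ w≢x w≢y) (Removal.∉T r a∉) (Removal.∉T r b∉) win′)

  afterMove : VSet n → Fin n → Hypergraph (Fin n)
  afterMove S v = nbhds S (λ u → ¬ Near G v u) None

  budget-DWin : ∀ {S R k} (ss : Star (Step G) S R) → DWin (closed S) k → Budget (suc k) (steps ss) R
  -- Of the `2`, one is the opening move `v` and the other the possible gain. Staller strips off
  -- pairs until `v` lies in the next one.
  budget-afterMove : ∀ {S R v k} (ss : Star (Step G) S R) → S v ≡ true → SWin (afterMove S v) k →
                 Budget (2 + k) (steps ss) R

  budget-DWin ε d = _ , n≤1+n _ , d
  budget-DWin (s ◅ ss) (done ∄e) = ⊥-elim (∄e (_ , Removal.x∈ (proj₁ (removal s)) , tt))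
  budget-DWin {S} ss@(_ ◅ _) (move v win) with S v in Sv
  ... | true  = budget-afterMove ss Sv (SWin-mono afterMove≼ win)
    where
    afterMove≼ : afterMove S v ≼ hit (closed S) v
    afterMove≼ (u , Su , far) = ((u , Su , tt) , λ { (inj₁ (_ , near)) → far near }) , λ _ → id
  ... | false = weaken (≤-trans (n≤1+n _) (n≤1+n _)) (all-forced ss (SWin-mono unhit win))
    where
    unhit : closed S ≼ hit (closed S) v
    unhit e = (e , λ { (inj₁ (Sv′ , _)) → true≢false Sv′ Sv }) , λ _ → id

  budget-afterMove {R = R} {v} ε v∈ win = _ , n≤1+n _ , move v (SWin-mono hit≼ win)
    where
    hit≼ : hit (closed R) v ≼ afterMove R v
    hit≼ ((u , Ru , _) , v∉) = (u , Ru , λ near → v∉ (inj₁ (v∈ , near))) , λ _ → id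
  budget-afterMove {S} {v = v} (_◅_ {j = T} s ss) v∈ win with removal s
  ... | r , inj₂ T-empty = emptied 1 T-empty ss (s≤s z≤n)
  ... | r , inj₁ att with v ≟ Removal.x r | v ≟ Removal.y r
  -- Staller answers the leaf by `y`, and Dominator is again first to move, now on `T`.
  ...   | yes refl | _ = suc-budget (budget-DWin ss (DWin-mono ≼x (answer win y)))
    where
    open Removal r
    ≼x : closed T ≼ cut (afterMove S x) y
    ≼x (u , Tu , _) = (u , proj₁ (T⁻ Tu) , far Tu) ,
      λ { w (inj₁ (Sw , near) , w≢y) → inj₁ (T⁺ Sw (λ { refl → far Tu near }) w≢y , near) }
  ...   | no _ | yes refl = suc-budget (budget-Predominated ss z∈ (SWin-mono ≼y win))
    where
    open Removal r
    open Attached att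
    ≼y : Predominated T z ≼ afterMove S y
    ≼y (u , Tu , u≢z) = (u , proj₁ (T⁻ Tu) , far-y Tu u≢z) ,
      λ { w (inj₁ (Sw , near)) → inj₁ (T⁺ Sw (λ { refl → far Tu near }) (λ { refl → far-y Tu u≢z near }) , near) }
  ...   | no v≢x | no v≢y with peel r {P = λ u → ¬ Near G v u} (λ _ p → p)
                                 ([ v≢x , v≢y ]′ ∘ Removal.leaf r v∈) (λ _ ()) (λ _ _ ()) win
  ...     | _ , refl , win′ = suc-budget (budget-afterMove ss (Removal.T⁺ r v∈ v≢x v≢y) win′)

  -- Return to the graph game and conclusion.

  position≼closed : ∀ S → position G S empty empty ≼ closed S
  position≼closed S (v , Sv , _) = (v , Sv , tt) , λ { u (inj₁ u∈) → u∈ , refl }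

  closed≼position : ∀ S → closed S ≼ position G S empty empty
  closed≼position S (v , Sv , _) = (v , Sv , λ { (_ , _ , () , _) }) , λ { u (u∈ , _) → inj₁ u∈ }

module _ (G : Graph n) {S : VSet n} where
  open Game G S

  WinD⇒closed : WinD k empty empty → DWin (closed G S) k
  WinD⇒closed w = DWin-mono (closed≼position G S) (toDWin G S w)

  closed⇒WinD : DWin (closed G S) k → WinD k empty empty
  closed⇒WinD d = fromDWin G S _ (DWin-mono (position≼closed G S) d)

  WinS⇒closed : WinS k empty empty → SWin (closed G S) k
  WinS⇒closed w = SWin-mono (closed≼position G S) (toSWin G S w)

  closed⇒WinS : SWin (closed G S) k → WinS k empty empty
  closed⇒WinS s = fromSWin G S _ (SWin-mono (position≼closed G S) s)

steps≡half : ∀ (G : Graph n) {R} (ss : Star (Step G) full R) → (n ∸ card R) / 2 ≡ steps G ss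
steps≡half {n} G {R} ss = trans (cong (_/ 2) n∸R≡) (m*n/n≡m m 2)
  where
  m : ℕ
  m = steps G ss
  n∸R≡ : n ∸ card R ≡ m * 2
  n∸R≡ = trans (cong (_∸ card R) (trans (≡-sym (card-full n)) (card-steps G ss)))
    (trans (m+n∸n≡m (m + m) (card R)) (trans (cong (m +_) (≡-sym (+-identityʳ m))) (*-comm 2 m)))

theorem4p4 : ∀ {n} (G : Graph n) (R : VSet n) → Residual G full R →
    ((a b : ℕ∞) → GammaS G full a → GammaS G R b →
    a ≡ ((n ∸ card R) / 2) +∞ b)
    ×
    ((a b : ℕ∞) → GammaD G full a → GammaD G R b →
    (pred∞ (((n ∸ card R) / 2) +∞ b) ≤∞ a) × (a ≤∞ (((n ∸ card R) / 2) +∞ b)))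
theorem4p4 {n} G R (ss , _) rewrite steps≡half G ss = S-game , λ a b γ γR → lower a b γ γR , upper a b γ γR
  where
  m : ℕ
  m = steps G ss

  S-game : (a b : ℕ∞) → GammaS G full a → GammaS G R b → a ≡ m +∞ b
  S-game (fin a) (fin b) (win , least) (winR , leastR) with SWin-steps⁻ G ss (WinS⇒closed G win)
  ... | j , refl , winⱼ = cong fin (≤-antisym
    (≮⇒≥ λ lt → least _ lt (closed⇒WinS G (SWin-steps G ss (WinS⇒closed G winR))))
    (+-monoʳ-≤ m (≮⇒≥ λ lt → leastR _ lt (closed⇒WinS G winⱼ))))
  S-game (fin a) ∞ (win , _) noWin with SWin-steps⁻ G ss (WinS⇒closed G win)
  ... | j , _ , winⱼ = ⊥-elim (noWin j (closed⇒WinS G winⱼ))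
  S-game ∞ (fin b) noWin (winR , _) = ⊥-elim (noWin _ (closed⇒WinS G (SWin-steps G ss (WinS⇒closed G winR))))
  S-game ∞ ∞ _ _ = refl

  lower : (a b : ℕ∞) → GammaD G full a → GammaD G R b → pred∞ (m +∞ b) ≤∞ a
  lower ∞ _ _ _ = ≤∞∞
  lower (fin a) (fin b) (win , _) (_ , leastR) with budget-DWin G ss (WinD⇒closed G win)
  -- Subtracting 1 from both sides of `m + b ≤ 1 + a` produces the `pred∞` of the bound.
  ... | j , m+j≤1+a , winⱼ = fin≤fin (∸-monoˡ-≤ 1
    (≤-trans (+-monoʳ-≤ m (≮⇒≥ λ lt → leastR _ lt (closed⇒WinD G winⱼ))) m+j≤1+a))
  lower (fin a) ∞ (win , _) noWin with budget-DWin G ss (WinD⇒closed G win)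
  ... | j , _ , winⱼ = ⊥-elim (noWin j (closed⇒WinD G winⱼ))

  upper : (a b : ℕ∞) → GammaD G full a → GammaD G R b → a ≤∞ (m +∞ b)
  upper _ ∞ _ _ = ≤∞∞
  upper (fin a) (fin b) (_ , least) (winR , _) =
    fin≤fin (≮⇒≥ λ lt → least _ lt (closed⇒WinD G (DWin-steps G ss (WinD⇒closed G winR))))
  upper ∞ (fin b) noWin (winR , _) = ⊥-elim (noWin _ (closed⇒WinD G (DWin-steps G ss (WinD⇒closed G winR))))
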